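{- Let $K = \mathbf{R}$ or $K = \mathbf{C}$, and let $h \geq 2$ and $n \geq 2$ be integers. Let $\mathcal{B}_h \subseteq K^n$ be the set of all $B_h$-vectors in $K^n$. Then $\mathcal{B}_h$ is a dense open subset of $K^n$.
   Context: A subset $A$ of $K$ is called a $B_h$-set if every element of $K$ has at most one representation (up to permutation of the summands) as the sum of $h$ not necessarily distinct elements of $A$. A vector $\mathbf{a} = (a_1,\ldots,a_n) \in K^n$ is called a $B_h$-vector if its coordinates $a_1,\ldots,a_n$ are pairwise distinct and the associated $n$-element set $A = \{a_1,\ldots,a_n\}$ is a $B_h$-set. The space $K^n$ carries its usual topology, given for instance by the norm $\|\mathbf{a}\|_\infty = \max_{1 \le i \le n} |a_i|$. -}

module Defs where

open import Algebra.Bundles using (AbelianGroup; CommutativeRing)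
import Algebra.Construct.DirectProduct as DirectProduct
open import Data.List.Base using (List; length; foldr)
import Data.List.Relation.Binary.Permutation.Setoid as Permutation
open import Data.List.Relation.Unary.All using (All)
open import Data.Nat.Base as ℕ using (ℕ; _⊔_)
import Data.Nat.Properties as ℕₚ
open import Data.Product.Base using (∃-syntax; _×_; _,_)
open import Data.Rational.Base as ℚ using (ℚ; 0ℚ; 1ℚ; ½)
import Data.Rational.Properties as ℚₚ
open import Data.Rational.Solver using (module +-*-Solver)
open import Data.Sum.Base using ([_,_]′)
open import Data.Vec.Functional using (Vector)
open import Level using (0ℓ)
open import Relation.Unary using (Pred)
open import Relation.Binary.PropositionalEquality
  using (_≡_; _≢_; refl; sym; cong; subst; module ≡-Reasoning)
open import Relation.Nullary using (¬_)

-- Real numbers are Cauchy sequences of rationals, taken up to _≃_.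
-- Statements about them are meant classically: inequality of reals is the
-- plain negation of _≃_ (not apartness), and results assume excluded
-- middle where they need it.

record ℝ : Set where
  constructor mkℝ
  field
    seq    : ℕ → ℚ
    cauchy : ∀ ε → 0ℚ ℚ.< ε →
             ∃[ N ] (∀ m n → N ℕ.≤ m → N ℕ.≤ n → ℚ.∣ seq m ℚ.- seq n ∣ ℚ.< ε)

open ℝ public

infix 4 _≃_ _<_

_≃_ : ℝ → ℝ → Set
x ≃ y = ∀ ε → 0ℚ ℚ.< ε →
        ∃[ N ] (∀ n → N ℕ.≤ n → ℚ.∣ seq x n ℚ.- seq y n ∣ ℚ.< ε)

_<_ : ℝ → ℝ → Set
x < y = ∃[ δ ] (0ℚ ℚ.< δ × ∃[ N ] (∀ n → N ℕ.≤ n → seq x n ℚ.+ δ ℚ.≤ seq y n))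

private
  half-pos : ∀ {ε} → 0ℚ ℚ.< ε → 0ℚ ℚ.< ε ℚ.* ½
  half-pos {ε} 0<ε = subst (ℚ._< ε ℚ.* ½) (ℚₚ.*-zeroˡ ½) (ℚₚ.*-monoˡ-<-pos ½ 0<ε)

  half+half : ∀ ε → ε ℚ.* ½ ℚ.+ ε ℚ.* ½ ≡ ε
  half+half = solve 1 (λ ε → ε :* con ½ :+ ε :* con ½ := ε) refl
    where open +-*-Solver

  +-halves : ∀ p q {ε} → ℚ.∣ p ∣ ℚ.< ε ℚ.* ½ → ℚ.∣ q ∣ ℚ.< ε ℚ.* ½ →
             ℚ.∣ p ℚ.+ q ∣ ℚ.< ε
  +-halves p q {ε} p< q< = ℚₚ.≤-<-trans (ℚₚ.∣p+q∣≤∣p∣+∣q∣ p q)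
    (subst (ℚ.∣ p ∣ ℚ.+ ℚ.∣ q ∣ ℚ.<_) (half+half ε) (ℚₚ.+-mono-< p< q<))

  ∣p-p∣<ε : ∀ p {q ε} → p ≡ q → 0ℚ ℚ.< ε → ℚ.∣ p ℚ.- q ∣ ℚ.< ε
  ∣p-p∣<ε p {ε = ε} refl = subst (λ r → ℚ.∣ r ∣ ℚ.< ε) (sym (ℚₚ.+-inverseʳ p))

  ∣p-q∣≡∣q-p∣ : ∀ p q → ℚ.∣ p ℚ.- q ∣ ≡ ℚ.∣ q ℚ.- p ∣
  ∣p-q∣≡∣q-p∣ p q = begin
    ℚ.∣ p ℚ.- q ∣         ≡⟨ ℚₚ.∣-p∣≡∣p∣ (p ℚ.- q) ⟨
    ℚ.∣ ℚ.- (p ℚ.- q) ∣   ≡⟨ cong ℚ.∣_∣ (solve 2 (λ p q → :- (p :- q) := q :- p) refl p q) ⟩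
    ℚ.∣ q ℚ.- p ∣         ∎
    where
    open +-*-Solver
    open ≡-Reasoning

  telescope : ∀ p q r → (p ℚ.- q) ℚ.+ (q ℚ.- r) ≡ p ℚ.- r
  telescope = solve 3 (λ p q r → (p :- q) :+ (q :- r) := p :- r) refl
    where open +-*-Solver

  ∣p∣-∣q∣≤∣p-q∣ : ∀ p q → ℚ.∣ p ∣ ℚ.- ℚ.∣ q ∣ ℚ.≤ ℚ.∣ p ℚ.- q ∣
  ∣p∣-∣q∣≤∣p-q∣ p q = begin
    ℚ.∣ p ∣ ℚ.- ℚ.∣ q ∣
      ≡⟨ cong (λ t → ℚ.∣ t ∣ ℚ.- ℚ.∣ q ∣) (solve 2 (λ p q → p := (p :- q) :+ q) refl p q) ⟩
    ℚ.∣ (p ℚ.- q) ℚ.+ q ∣ ℚ.- ℚ.∣ q ∣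
      ≤⟨ ℚₚ.+-monoˡ-≤ (ℚ.- ℚ.∣ q ∣) (ℚₚ.∣p+q∣≤∣p∣+∣q∣ (p ℚ.- q) q) ⟩
    (ℚ.∣ p ℚ.- q ∣ ℚ.+ ℚ.∣ q ∣) ℚ.- ℚ.∣ q ∣
      ≡⟨ solve 2 (λ a b → (a :+ b) :- b := a) refl ℚ.∣ p ℚ.- q ∣ ℚ.∣ q ∣ ⟩
    ℚ.∣ p ℚ.- q ∣ ∎
    where
    open +-*-Solver
    open ℚₚ.≤-Reasoning

  ∣∣p∣-∣q∣∣≤∣p-q∣ : ∀ p q → ℚ.∣ ℚ.∣ p ∣ ℚ.- ℚ.∣ q ∣ ∣ ℚ.≤ ℚ.∣ p ℚ.- q ∣
  ∣∣p∣-∣q∣∣≤∣p-q∣ p q = [ case₁ , case₂ ]′ (ℚₚ.∣p∣≡p∨∣p∣≡-p d)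
    where
    open +-*-Solver
    open ℚₚ.≤-Reasoning
    d = ℚ.∣ p ∣ ℚ.- ℚ.∣ q ∣
    case₁ : ℚ.∣ d ∣ ≡ d → ℚ.∣ d ∣ ℚ.≤ ℚ.∣ p ℚ.- q ∣
    case₁ eq = begin
      ℚ.∣ d ∣         ≡⟨ eq ⟩
      d               ≤⟨ ∣p∣-∣q∣≤∣p-q∣ p q ⟩
      ℚ.∣ p ℚ.- q ∣   ∎
    case₂ : ℚ.∣ d ∣ ≡ ℚ.- d → ℚ.∣ d ∣ ℚ.≤ ℚ.∣ p ℚ.- q ∣
    case₂ eq = begin
      ℚ.∣ d ∣               ≡⟨ eq ⟩
      ℚ.- d                 ≡⟨ solve 2 (λ a b → :- (a :- b) := b :- a) refl ℚ.∣ p ∣ ℚ.∣ q ∣ ⟩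
      ℚ.∣ q ∣ ℚ.- ℚ.∣ p ∣   ≤⟨ ∣p∣-∣q∣≤∣p-q∣ q p ⟩
      ℚ.∣ q ℚ.- p ∣         ≡⟨ ∣p-q∣≡∣q-p∣ q p ⟩
      ℚ.∣ p ℚ.- q ∣         ∎

  +-diff : ∀ p q r s → (p ℚ.- q) ℚ.+ (r ℚ.- s) ≡ (p ℚ.+ r) ℚ.- (q ℚ.+ s)
  +-diff = solve 4 (λ p q r s → (p :- q) :+ (r :- s) := (p :+ r) :- (q :+ s)) refl
    where open +-*-Solver

  *-diff : ∀ p q r s → p ℚ.* (r ℚ.- s) ℚ.+ s ℚ.* (p ℚ.- q) ≡ p ℚ.* r ℚ.- q ℚ.* s
  *-diff = solve 4 (λ p q r s → p :* (r :- s) :+ s :* (p :- q) := p :* r :- q :* s) refl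
    where open +-*-Solver

  neg-diff : ∀ p q → ℚ.- p ℚ.- (ℚ.- q) ≡ q ℚ.- p
  neg-diff = solve 2 (λ p q → :- p :- (:- q) := q :- p) refl
    where open +-*-Solver

  shrink : ∀ B → 0ℚ ℚ.< B → ∀ ε → 0ℚ ℚ.< ε →
           ∃[ δ ] (0ℚ ℚ.< δ × B ℚ.* δ ≡ ε)
  shrink B 0<B ε 0<ε = δ , 0<δ , Bδ≡ε
    where
    instance
      B-pos : ℚ.Positive B
      B-pos = ℚ.positive 0<B
      B-nonZero : ℚ.NonZero B
      B-nonZero = ℚₚ.pos⇒nonZero B
      1/B-pos : ℚ.Positive (ℚ.1/ B)
      1/B-pos = ℚₚ.1/pos⇒pos B
    δ = ε ℚ.* ℚ.1/ B
    0<δ : 0ℚ ℚ.< δ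
    0<δ = subst (ℚ._< δ) (ℚₚ.*-zeroˡ (ℚ.1/ B)) (ℚₚ.*-monoˡ-<-pos (ℚ.1/ B) 0<ε)
    Bδ≡ε : B ℚ.* δ ≡ ε
    Bδ≡ε = begin
      B ℚ.* (ε ℚ.* ℚ.1/ B)   ≡⟨ ℚₚ.*-comm B δ ⟩
      ε ℚ.* ℚ.1/ B ℚ.* B     ≡⟨ ℚₚ.*-assoc ε (ℚ.1/ B) B ⟩
      ε ℚ.* (ℚ.1/ B ℚ.* B)   ≡⟨ cong (ε ℚ.*_) (ℚₚ.*-inverseˡ B) ⟩
      ε ℚ.* 1ℚ               ≡⟨ ℚₚ.*-identityʳ ε ⟩
      ε                      ∎
      where open ≡-Reasoning

  *-bound : ∀ p q {B δ} → 0ℚ ℚ.< B → ℚ.∣ p ∣ ℚ.< B → ℚ.∣ q ∣ ℚ.< δ →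
            ℚ.∣ p ℚ.* q ∣ ℚ.< B ℚ.* δ
  *-bound p q {B} {δ} 0<B p<B q<δ = begin-strict
    ℚ.∣ p ℚ.* q ∣         ≡⟨ ℚₚ.∣p*q∣≡∣p∣*∣q∣ p q ⟩
    ℚ.∣ p ∣ ℚ.* ℚ.∣ q ∣   ≤⟨ ℚₚ.*-monoʳ-≤-nonNeg ℚ.∣ q ∣ {{ℚₚ.∣-∣-nonNeg q}} (ℚₚ.<⇒≤ p<B) ⟩
    B ℚ.* ℚ.∣ q ∣         <⟨ ℚₚ.*-monoʳ-<-pos B {{ℚ.positive 0<B}} q<δ ⟩
    B ℚ.* δ               ∎
    where open ℚₚ.≤-Reasoning

  eventually-bounded : ∀ x → ∃[ B ] (0ℚ ℚ.< B ×
                       ∃[ N ] (∀ n → N ℕ.≤ n → ℚ.∣ seq x n ∣ ℚ.< B))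
  eventually-bounded x with cauchy x 1ℚ (ℚₚ.positive⁻¹ 1ℚ)
  ... | N , close = B , 0<B , N , λ n N≤n → begin-strict
      ℚ.∣ seq x n ∣
        ≡⟨ cong ℚ.∣_∣ (solve 2 (λ p q → p := (p :- q) :+ q) refl (seq x n) (seq x N)) ⟩
      ℚ.∣ (seq x n ℚ.- seq x N) ℚ.+ seq x N ∣
        ≤⟨ ℚₚ.∣p+q∣≤∣p∣+∣q∣ (seq x n ℚ.- seq x N) (seq x N) ⟩
      ℚ.∣ seq x n ℚ.- seq x N ∣ ℚ.+ ℚ.∣ seq x N ∣
        <⟨ ℚₚ.+-monoˡ-< ℚ.∣ seq x N ∣ (close n N N≤n ℕₚ.≤-refl) ⟩
      B ∎
    where
    open +-*-Solver
    open ℚₚ.≤-Reasoning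
    B = 1ℚ ℚ.+ ℚ.∣ seq x N ∣
    0<B : 0ℚ ℚ.< B
    0<B = ℚₚ.+-mono-<-≤ (ℚₚ.positive⁻¹ 1ℚ) (ℚₚ.0≤∣p∣ (seq x N))

  *-close : ∀ p q r s {B C β γ ε} → 0ℚ ℚ.< B → 0ℚ ℚ.< C →
            B ℚ.* β ≡ ε ℚ.* ½ → C ℚ.* γ ≡ ε ℚ.* ½ →
            ℚ.∣ p ∣ ℚ.< B → ℚ.∣ s ∣ ℚ.< C →
            ℚ.∣ r ℚ.- s ∣ ℚ.< β → ℚ.∣ p ℚ.- q ∣ ℚ.< γ →
            ℚ.∣ p ℚ.* r ℚ.- q ℚ.* s ∣ ℚ.< ε
  *-close p q r s {ε = ε} 0<B 0<C Bβ Cγ p<B s<C rs pq =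
    subst (λ t → ℚ.∣ t ∣ ℚ.< ε) (*-diff p q r s)
      (+-halves (p ℚ.* (r ℚ.- s)) (s ℚ.* (p ℚ.- q))
        (subst (ℚ.∣ p ℚ.* (r ℚ.- s) ∣ ℚ.<_) Bβ (*-bound p (r ℚ.- s) 0<B p<B rs))
        (subst (ℚ.∣ s ℚ.* (p ℚ.- q) ∣ ℚ.<_) Cγ (*-bound s (p ℚ.- q) 0<C s<C pq)))

  ⊔-left : ∀ {n} a b → a ⊔ b ℕ.≤ n → a ℕ.≤ n
  ⊔-left a b = ℕₚ.m⊔n≤o⇒m≤o a b

  ⊔-right : ∀ {n} a b → a ⊔ b ℕ.≤ n → b ℕ.≤ n
  ⊔-right a b = ℕₚ.m⊔n≤o⇒n≤o a b

fromℚ : ℚ → ℝ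
fromℚ q = mkℝ (λ _ → q) (λ ε 0<ε → 0 , λ _ _ _ _ → ∣p-p∣<ε q refl 0<ε)

0ℝ 1ℝ : ℝ
0ℝ = fromℚ 0ℚ
1ℝ = fromℚ 1ℚ

infixl 6 _+_ _-_
infixl 7 _*_
infix  8 -_

_+_ : ℝ → ℝ → ℝ
seq (x + y) n = seq x n ℚ.+ seq y n
cauchy (x + y) ε 0<ε =
  let N , f = cauchy x (ε ℚ.* ½) (half-pos 0<ε)
      M , g = cauchy y (ε ℚ.* ½) (half-pos 0<ε)
  in N ⊔ M , λ m n m≥ n≥ →
  subst (λ t → ℚ.∣ t ∣ ℚ.< ε) (+-diff (seq x m) (seq x n) (seq y m) (seq y n))
    (+-halves (seq x m ℚ.- seq x n) (seq y m ℚ.- seq y n)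
      (f m n (⊔-left N M m≥) (⊔-left N M n≥))
      (g m n (⊔-right N M m≥) (⊔-right N M n≥)))

-_ : ℝ → ℝ
seq (- x) n = ℚ.- seq x n
cauchy (- x) ε 0<ε =
  let N , f = cauchy x ε 0<ε
  in N , λ m n m≥ n≥ →
  subst (λ t → ℚ.∣ t ∣ ℚ.< ε) (sym (neg-diff (seq x m) (seq x n))) (f n m n≥ m≥)

_-_ : ℝ → ℝ → ℝ
x - y = x + (- y)

_*_ : ℝ → ℝ → ℝ
seq (x * y) n = seq x n ℚ.* seq y n
cauchy (x * y) ε 0<ε =
  let B , 0<B , N₁ , x<B = eventually-bounded x
      C , 0<C , N₂ , y<C = eventually-bounded y
      β , 0<β , Bβ = shrink B 0<B (ε ℚ.* ½) (half-pos 0<ε)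
      γ , 0<γ , Cγ = shrink C 0<C (ε ℚ.* ½) (half-pos 0<ε)
      N₃ , f = cauchy y β 0<β
      N₄ , g = cauchy x γ 0<γ
  in (N₁ ⊔ N₂) ⊔ (N₃ ⊔ N₄) , λ m n m≥ n≥ →
  *-close (seq x m) (seq x n) (seq y m) (seq y n) {ε = ε} 0<B 0<C Bβ Cγ
    (x<B m (⊔-left N₁ N₂ (⊔-left (N₁ ⊔ N₂) (N₃ ⊔ N₄) m≥)))
    (y<C n (⊔-right N₁ N₂ (⊔-left (N₁ ⊔ N₂) (N₃ ⊔ N₄) n≥)))
    (f m n (⊔-left N₃ N₄ (⊔-right (N₁ ⊔ N₂) (N₃ ⊔ N₄) m≥))
           (⊔-left N₃ N₄ (⊔-right (N₁ ⊔ N₂) (N₃ ⊔ N₄) n≥)))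
    (g m n (⊔-right N₃ N₄ (⊔-right (N₁ ⊔ N₂) (N₃ ⊔ N₄) m≥))
           (⊔-right N₃ N₄ (⊔-right (N₁ ⊔ N₂) (N₃ ⊔ N₄) n≥)))

∣_∣ : ℝ → ℝ
seq ∣ x ∣ n = ℚ.∣ seq x n ∣
cauchy ∣ x ∣ ε 0<ε =
  let N , f = cauchy x ε 0<ε
  in N , λ m n m≥ n≥ →
  ℚₚ.≤-<-trans (∣∣p∣-∣q∣∣≤∣p-q∣ (seq x m) (seq x n)) (f m n m≥ n≥)

private
  pointwise : ∀ x y → (∀ n → seq x n ≡ seq y n) → x ≃ y
  pointwise x y eq ε 0<ε = 0 , λ n _ → ∣p-p∣<ε (seq x n) (eq n) 0<ε

  ≃-refl : ∀ {x} → x ≃ x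
  ≃-refl {x} = pointwise x x (λ _ → refl)

  ≃-sym : ∀ {x y} → x ≃ y → y ≃ x
  ≃-sym {x} {y} x≃y ε 0<ε =
    let N , f = x≃y ε 0<ε
    in N , λ n n≥ → subst (ℚ._< ε) (∣p-q∣≡∣q-p∣ (seq x n) (seq y n)) (f n n≥)

  ≃-trans : ∀ {x y z} → x ≃ y → y ≃ z → x ≃ z
  ≃-trans {x} {y} {z} x≃y y≃z ε 0<ε =
    let N , f = x≃y (ε ℚ.* ½) (half-pos 0<ε)
        M , g = y≃z (ε ℚ.* ½) (half-pos 0<ε)
    in N ⊔ M , λ n n≥ →
    subst (λ t → ℚ.∣ t ∣ ℚ.< ε) (telescope (seq x n) (seq y n) (seq z n))
      (+-halves (seq x n ℚ.- seq y n) (seq y n ℚ.- seq z n)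
        (f n (⊔-left N M n≥)) (g n (⊔-right N M n≥)))

  +-cong : ∀ {x x′ y y′} → x ≃ x′ → y ≃ y′ → x + y ≃ x′ + y′
  +-cong {x} {x′} {y} {y′} x≃x′ y≃y′ ε 0<ε =
    let N , f = x≃x′ (ε ℚ.* ½) (half-pos 0<ε)
        M , g = y≃y′ (ε ℚ.* ½) (half-pos 0<ε)
    in N ⊔ M , λ n n≥ →
    subst (λ t → ℚ.∣ t ∣ ℚ.< ε) (+-diff (seq x n) (seq x′ n) (seq y n) (seq y′ n))
      (+-halves (seq x n ℚ.- seq x′ n) (seq y n ℚ.- seq y′ n)
        (f n (⊔-left N M n≥)) (g n (⊔-right N M n≥)))

  -‿cong : ∀ {x y} → x ≃ y → - x ≃ - y
  -‿cong {x} {y} x≃y ε 0<ε =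
    let N , f = ≃-sym {x} {y} x≃y ε 0<ε
    in N , λ n n≥ →
    subst (λ t → ℚ.∣ t ∣ ℚ.< ε) (sym (neg-diff (seq x n) (seq y n))) (f n n≥)

  *-cong : ∀ {x x′ y y′} → x ≃ x′ → y ≃ y′ → x * y ≃ x′ * y′
  *-cong {x} {x′} {y} {y′} x≃x′ y≃y′ ε 0<ε =
    let B , 0<B , N₁ , x<B = eventually-bounded x
        C , 0<C , N₂ , y<C = eventually-bounded y′
        β , 0<β , Bβ = shrink B 0<B (ε ℚ.* ½) (half-pos 0<ε)
        γ , 0<γ , Cγ = shrink C 0<C (ε ℚ.* ½) (half-pos 0<ε)
        N₃ , f = y≃y′ β 0<β
        N₄ , g = x≃x′ γ 0<γ
    in (N₁ ⊔ N₂) ⊔ (N₃ ⊔ N₄) , λ n n≥ →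
    *-close (seq x n) (seq x′ n) (seq y n) (seq y′ n) {ε = ε} 0<B 0<C Bβ Cγ
      (x<B n (⊔-left N₁ N₂ (⊔-left (N₁ ⊔ N₂) (N₃ ⊔ N₄) n≥)))
      (y<C n (⊔-right N₁ N₂ (⊔-left (N₁ ⊔ N₂) (N₃ ⊔ N₄) n≥)))
      (f n (⊔-left N₃ N₄ (⊔-right (N₁ ⊔ N₂) (N₃ ⊔ N₄) n≥)))
      (g n (⊔-right N₃ N₄ (⊔-right (N₁ ⊔ N₂) (N₃ ⊔ N₄) n≥)))

ℝ-commutativeRing : CommutativeRing 0ℓ 0ℓ
ℝ-commutativeRing = record
  { Carrier = ℝ
  ; _≈_ = _≃_
  ; _+_ = _+_
  ; _*_ = _*_
  ; -_ = -_
  ; 0# = 0ℝ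
  ; 1# = 1ℝ
  ; isCommutativeRing = record
    { isRing = record
      { +-isAbelianGroup = record
        { isGroup = record
          { isMonoid = record
            { isSemigroup = record
              { isMagma = record
                { isEquivalence = record
                  { refl = λ {x} → ≃-refl {x}
                  ; sym = λ {x y} → ≃-sym {x} {y}
                  ; trans = λ {x y z} → ≃-trans {x} {y} {z}
                  }
                ; ∙-cong = λ {x x′ y y′} → +-cong {x} {x′} {y} {y′}
                }
              ; assoc = λ x y z → pointwise ((x + y) + z) (x + (y + z))
                  (λ n → ℚₚ.+-assoc (seq x n) (seq y n) (seq z n))
              }
            ; identity = (λ x → pointwise (0ℝ + x) x (λ n → ℚₚ.+-identityˡ (seq x n)))
                       , (λ x → pointwise (x + 0ℝ) x (λ n → ℚₚ.+-identityʳ (seq x n)))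
            }
          ; inverse = (λ x → pointwise (- x + x) 0ℝ (λ n → ℚₚ.+-inverseˡ (seq x n)))
                    , (λ x → pointwise (x - x) 0ℝ (λ n → ℚₚ.+-inverseʳ (seq x n)))
          ; ⁻¹-cong = λ {x y} → -‿cong {x} {y}
          }
        ; comm = λ x y → pointwise (x + y) (y + x) (λ n → ℚₚ.+-comm (seq x n) (seq y n))
        }
      ; *-cong = λ {x x′ y y′} → *-cong {x} {x′} {y} {y′}
      ; *-assoc = λ x y z → pointwise ((x * y) * z) (x * (y * z))
          (λ n → ℚₚ.*-assoc (seq x n) (seq y n) (seq z n))
      ; *-identity = (λ x → pointwise (1ℝ * x) x (λ n → ℚₚ.*-identityˡ (seq x n)))
                   , (λ x → pointwise (x * 1ℝ) x (λ n → ℚₚ.*-identityʳ (seq x n)))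
      ; distrib = (λ x y z → pointwise (x * (y + z)) (x * y + x * z)
                     (λ n → ℚₚ.*-distribˡ-+ (seq x n) (seq y n) (seq z n)))
                , (λ x y z → pointwise ((y + z) * x) (y * x + z * x)
                     (λ n → ℚₚ.*-distribʳ-+ (seq x n) (seq y n) (seq z n)))
      }
    ; *-comm = λ x y → pointwise (x * y) (y * x) (λ n → ℚₚ.*-comm (seq x n) (seq y n))
    }
  }

ℝ-abelianGroup : AbelianGroup 0ℓ 0ℓ
ℝ-abelianGroup = CommutativeRing.+-abelianGroup ℝ-commutativeRing

-- A complex number is the pair of its real and imaginary parts.

ℂ-abelianGroup : AbelianGroup 0ℓ 0ℓ
ℂ-abelianGroup = DirectProduct.abelianGroup ℝ-abelianGroup ℝ-abelianGroup

module _ (G : AbelianGroup 0ℓ 0ℓ) where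

  open AbelianGroup G using (Carrier; _≈_; _∙_; ε; setoid)
  open Permutation setoid using (_↭_)

  sum : List Carrier → Carrier
  sum = foldr _∙_ ε

  -- Lists up to _↭_ are unordered sums, so u lists the h summands of x.
  IsRepresentation : ℕ → Pred Carrier 0ℓ → Carrier → List Carrier → Set
  IsRepresentation h A x u = length u ≡ h × All A u × sum u ≈ x

  IsBhSet : ℕ → Pred Carrier 0ℓ → Set
  IsBhSet h A = ∀ x u v → IsRepresentation h A x u → IsRepresentation h A x v → u ↭ v

  Coordinates : ∀ {n} → Vector Carrier n → Pred Carrier 0ℓ
  Coordinates a x = ∃[ i ] (x ≈ a i)

  IsBhVector : ∀ {n} → ℕ → Vector Carrier n → Set
  IsBhVector h a = (∀ i j → i ≢ j → ¬ (a i ≈ a j)) × IsBhSet h (Coordinates a)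

data Scalars : Set where
  real complex : Scalars

additiveGroup : Scalars → AbelianGroup 0ℓ 0ℓ
additiveGroup real    = ℝ-abelianGroup
additiveGroup complex = ℂ-abelianGroup

⟦_⟧ : Scalars → Set
⟦ K ⟧ = AbelianGroup.Carrier (additiveGroup K)

-- The relation |z| < r. For complex z = x + iy the modulus √(x² + y²) is
-- compared with r through squares.

AbsLess : ∀ K → ⟦ K ⟧ → ℝ → Set
AbsLess real    x       r = ∣ x ∣ < r
AbsLess complex (x , y) r = 0ℝ < r × x * x + y * y < r * r

-- ‖b - a‖∞ < r. This is the n-fold conjunction, the maximum being over
-- finitely many coordinates; for n = 0 it does not force 0 < r.

InBall : ∀ K {n} → Vector ⟦ K ⟧ n → ℝ → Vector ⟦ K ⟧ n → Set
InBall K a r b = ∀ i → AbsLess K (b i ∙ (a i) ⁻¹) r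
  where open AbelianGroup (additiveGroup K) using (_∙_; _⁻¹)

IsOpen : ∀ K {n} → Pred (Vector ⟦ K ⟧ n) 0ℓ → Set
IsOpen K U = ∀ a → U a → ∃[ r ] (0ℝ < r × (∀ b → InBall K a r b → U b))

IsDense : ∀ K {n} → Pred (Vector ⟦ K ⟧ n) 0ℓ → Set
IsDense K U = ∀ a r → 0ℝ < r → ∃[ b ] (InBall K a r b × U b)

{-# OPTIONS --safe #-}
module Submission where

-- An index list of length h is determined up to order by its weight Σ (1+h)^i,
-- since it uses no index more than h times. Translating a by q·((1+h)^i)ᵢ
-- therefore shifts the sums of two non-permuted index lists by distinct
-- multiples of q, so these sums agree for at most one q. There are finitely
-- many pairs of lists, hence every sufficiently small q > 0 gives a B_h-vector:
-- this is density. Openness holds because the finitely many sums that differ at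
-- a still differ near a.

open import Defs
open import Axiom.ExcludedMiddle using (ExcludedMiddle)
open import Data.Nat.Base using (ℕ; _≤_)
open import Data.Product.Base using (_×_)
open import Level using (0ℓ)

open import Algebra.Bundles using (AbelianGroup)
import Algebra.Construct.DirectProduct as DirectProduct
import Algebra.Definitions.RawMonoid as RawMonoid
import Algebra.Properties.AbelianGroup as AbelianGroupProperties
import Algebra.Properties.CommutativeSemigroup as CommutativeSemigroupProperties
import Algebra.Properties.Monoid.Mult as MonoidMult
open import Axiom.DoubleNegationElimination using (em⇒dne)
open import Data.Empty using (⊥-elim)
open import Data.Fin.Base using (Fin; zero; suc; toℕ)
open import Data.List.Base using (List; []; _∷_; _++_; length; map; replicate)
import Data.List.Properties as Listₚ
open import Data.List.Relation.Binary.Permutation.Propositional as ↭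
  using (_↭_; ↭-sym; ↭-trans)
import Data.List.Relation.Binary.Permutation.Propositional.Properties as ↭ₚ
import Data.List.Relation.Binary.Permutation.Setoid as SetoidPermutation
import Data.List.Relation.Binary.Permutation.Setoid.Properties as SetoidPermutationₚ
open import Data.List.Relation.Binary.Pointwise as Pointwise using (Pointwise; []; _∷_)
open import Data.List.Relation.Unary.All as All using (All; []; _∷_)
import Data.List.Relation.Unary.All.Properties as Allₚ
open import Data.Nat.ListAction using () renaming (sum to sumℕ)
open import Data.Nat.Base as ℕ using (zero; suc; _^_; s≤s)
import Data.Nat.DivMod as ℕ
import Data.Nat.Properties as ℕₚ
import Data.Nat.Solver as ℕ-Solver
open import Data.Product.Base using (∃-syntax; _,_; proj₁; proj₂)
open import Data.Rational.Base as ℚ using (ℚ; 0ℚ; 1ℚ; ½)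
import Data.Rational.Properties as ℚₚ
import Data.Rational.Solver as ℚ-Solver
open import Data.Sum.Base using (inj₁; inj₂)
open import Data.Vec.Functional using (Vector)
open import Function.Base using (_∘_)
open import Relation.Binary.Definitions using (tri<; tri≈; tri>)
open import Relation.Binary.PropositionalEquality as ≡
  using (_≡_; _≢_; refl; cong; cong₂; subst; subst₂)
open import Relation.Nullary using (¬_; yes; no)
open import Relation.Nullary.Negation using (contradiction)

-- Base-B weights of index lists

weight : ∀ {n} → ℕ → List (Fin n) → ℕ
weight B is = sumℕ (map (λ i → B ^ toℕ i) is)

-- Splits off the lowest digit: an index `zero` contributes B^0 = 1, while `suc i` contributes `B`
-- times the contribution of `i`. Gathering the zeros in front costs only a permutation.
splitZeros : ∀ {n} B (is : List (Fin (suc n))) → ∃[ k ] ∃[ js ]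
             (is ↭ replicate k zero ++ map suc js ×
              weight B is ≡ k ℕ.+ weight B js ℕ.* B)
splitZeros B [] = 0 , [] , ↭.refl , refl
splitZeros B (zero ∷ is) =
  let k , js , p , e = splitZeros B is
  in suc k , js , ↭.prep zero p , cong suc e
splitZeros B (suc i ∷ is) =
  let k , js , p , e = splitZeros B is
  in k , i ∷ js
   , ↭-trans (↭.prep (suc i) p) (↭-sym (↭ₚ.shift (suc i) (replicate k zero) (map suc js)))
   , ≡.trans (cong (B ℕ.* B ^ toℕ i ℕ.+_) e) (regroup B (B ^ toℕ i) k (weight B js))
  where
  open ℕ-Solver.+-*-Solver
  regroup : ∀ b c k w → b ℕ.* c ℕ.+ (k ℕ.+ w ℕ.* b) ≡ k ℕ.+ (c ℕ.+ w) ℕ.* b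
  regroup = solve 4 (λ b c k w → b :* c :+ (k :+ w :* b) := k :+ (c :+ w) :* b) refl

-- Reduction modulo `B` recovers the remainders `k` and `l`; cancellation then gives the quotients.
digit-unique : ∀ {B k l} v w → k ℕ.< B → l ℕ.< B →
               k ℕ.+ v ℕ.* B ≡ l ℕ.+ w ℕ.* B → k ≡ l × v ≡ w
digit-unique {B@(suc _)} {k} {l} v w k<B l<B eq = k≡l , v≡w
  where
  open ≡.≡-Reasoning
  k≡l : k ≡ l
  k≡l = begin
    k                         ≡⟨ ℕ.m<n⇒m%n≡m k<B ⟨
    k ℕ.% B                   ≡⟨ ℕ.[m+kn]%n≡m%n k v B ⟨
    (k ℕ.+ v ℕ.* B) ℕ.% B     ≡⟨ cong (ℕ._% B) eq ⟩
    (l ℕ.+ w ℕ.* B) ℕ.% B     ≡⟨ ℕ.[m+kn]%n≡m%n l w B ⟩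
    l ℕ.% B                   ≡⟨ ℕ.m<n⇒m%n≡m l<B ⟩
    l                         ∎
  v≡w : v ≡ w
  v≡w = ℕₚ.*-cancelʳ-≡ v w B (ℕₚ.+-cancelˡ-≡ k (v ℕ.* B) (w ℕ.* B)
          (≡.trans eq (cong (ℕ._+ w ℕ.* B) (≡.sym k≡l))))

-- Induction on `n`, one digit at a time. The multiplicity of `zero` is at most the length, hence
-- below `B`, so no carries occur: the lowest digits agree, and the quotients are the weights of
-- lists over one index fewer.
weight-injective : ∀ {n B} (is js : List (Fin n)) → length is ℕ.< B → length js ℕ.< B →
                   weight B is ≡ weight B js → is ↭ js
weight-injective {zero} [] [] _ _ _ = ↭.refl
weight-injective {suc n} {B} is js is<B js<B eq =
  let k , is′ , p , e = splitZeros B is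
      l , js′ , q , f = splitZeros B js
      |is| = lengths k is′ p
      |js| = lengths l js′ q
      k≡l , w≡w = digit-unique (weight B is′) (weight B js′)
        (ℕₚ.m+n≤o⇒m≤o (suc k) (subst (ℕ._< B) |is| is<B))
        (ℕₚ.m+n≤o⇒m≤o (suc l) (subst (ℕ._< B) |js| js<B))
        (≡.trans (≡.sym e) (≡.trans eq f))
      is′↭js′ = weight-injective is′ js′
        (ℕₚ.≤-<-trans (ℕₚ.m≤n+m _ k) (subst (ℕ._< B) |is| is<B))
        (ℕₚ.≤-<-trans (ℕₚ.m≤n+m _ l) (subst (ℕ._< B) |js| js<B)) w≡w
  in ↭-trans p (↭-trans (subst (λ m → _ ↭ replicate m zero ++ map suc js′) k≡l
                          (↭ₚ.++⁺ˡ (replicate k zero) (↭ₚ.map⁺ suc is′↭js′)))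
                        (↭-sym q))
  where
  lengths : ∀ {ks : List (Fin (suc n))} k (ks′ : List (Fin n)) →
            ks ↭ replicate k zero ++ map suc ks′ → length ks ≡ k ℕ.+ length ks′
  lengths k ks′ p = ≡.trans (↭ₚ.↭-length p) (≡.trans (Listₚ.length-++ (replicate k zero))
    (cong₂ ℕ._+_ (Listₚ.length-replicate k) (Listₚ.length-map suc ks′)))

-- Properties of all sufficiently small positive rationals

½-pos : ∀ {p} → 0ℚ ℚ.< p → 0ℚ ℚ.< p ℚ.* ½
½-pos {p} 0<p = subst (ℚ._< p ℚ.* ½) (ℚₚ.*-zeroˡ ½) (ℚₚ.*-monoˡ-<-pos ½ 0<p)

½+½ : ∀ p → p ℚ.* ½ ℚ.+ p ℚ.* ½ ≡ p
½+½ = solve 1 (λ p → p :* con ½ :+ p :* con ½ := p) refl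
  where open ℚ-Solver.+-*-Solver

-- Membership in the filter of right neighbourhoods of 0. The interval is closed at `ρ`, so `ρ`
-- itself serves as an instance.
Small : (ℚ → Set) → Set
Small P = ∃[ ρ ] (0ℚ ℚ.< ρ × (∀ q → 0ℚ ℚ.< q → q ℚ.≤ ρ → P q))

module _ {P Q : ℚ → Set} where

  small-map : (∀ q → 0ℚ ℚ.< q → P q → Q q) → Small P → Small Q
  small-map f (ρ , 0<ρ , h) = ρ , 0<ρ , λ q 0<q q≤ρ → f q 0<q (h q 0<q q≤ρ)

  small-× : Small P → Small Q → Small (λ q → P q × Q q)
  small-× (ρ , 0<ρ , f) (σ , 0<σ , g) with ℚₚ.≤-total ρ σ
  ... | inj₁ ρ≤σ = ρ , 0<ρ , λ q 0<q q≤ρ → f q 0<q q≤ρ , g q 0<q (ℚₚ.≤-trans q≤ρ ρ≤σ)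
  ... | inj₂ σ≤ρ = σ , 0<σ , λ q 0<q q≤σ → f q 0<q (ℚₚ.≤-trans q≤σ σ≤ρ) , g q 0<q q≤σ

small-always : ∀ {P : ℚ → Set} → (∀ q → 0ℚ ℚ.< q → P q) → Small P
small-always f = 1ℚ , ℚₚ.positive⁻¹ 1ℚ , λ q 0<q _ → f q 0<q

small-< : ∀ {δ} → 0ℚ ℚ.< δ → Small (ℚ._< δ)
small-< 0<δ =
  let ρ , 0<ρ , ρ<δ = ℚₚ.<-dense 0<δ
  in ρ , 0<ρ , λ q _ q≤ρ → ℚₚ.≤-<-trans q≤ρ ρ<δ

small-Fin : ∀ {n} {P : Fin n → ℚ → Set} → (∀ i → Small (P i)) → Small (λ q → ∀ i → P i q)
small-Fin {zero} _ = small-always λ _ _ ()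
small-Fin {suc n} f = small-map (λ { q _ (p , ps) zero → p ; q _ (p , ps) (suc i) → ps i })
  (small-× (f zero) (small-Fin (f ∘ suc)))

-- There are finitely many lists of a given length over `Fin n`, so this is a finite intersection,
-- formed entry by entry.
small-lists : ∀ {n} h {P : List (Fin n) → ℚ → Set} → (∀ is → length is ≡ h → Small (P is)) →
              Small (λ q → ∀ is → length is ≡ h → P is q)
small-lists zero f = small-map (λ { q _ p [] _ → p }) (f [] refl)
small-lists (suc h) f = small-map (λ { q _ p (i ∷ is) eq → p i is (ℕₚ.suc-injective eq) })
  (small-Fin λ i → small-lists h λ is eq → f (i ∷ is) (cong suc eq))

-- Either no positive rational satisfies `P`, or there is exactly one, and everything below it
-- avoids `P`.
small-avoids : ExcludedMiddle 0ℓ → ∀ {P : ℚ → Set} →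
               (∀ p q → P p → P q → p ≡ q) → Small (λ q → ¬ P q)
small-avoids em {P} unique with em {∃[ p ] (0ℚ ℚ.< p × P p)}
... | no none = small-always λ q 0<q Pq → none (q , 0<q , Pq)
... | yes (p , 0<p , Pp) =
  small-map (λ q _ q<p Pq → ℚₚ.<-irrefl (unique q p Pq Pp) q<p) (small-< 0<p)

-- Multiples of a rational

open RawMonoid ℚ.+-0-rawMonoid using () renaming (_×_ to _·_)

·-monoʳ-< : ∀ k {p q} → p ℚ.< q → suc k · p ℚ.< suc k · q
·-monoʳ-< zero p<q = ℚₚ.+-monoˡ-< 0ℚ p<q
·-monoʳ-< (suc k) p<q = ℚₚ.+-mono-< p<q (·-monoʳ-< k p<q)

·-injectiveʳ : ∀ k {p q} → suc k · p ≡ suc k · q → p ≡ q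
·-injectiveʳ k {p} {q} eq with ℚₚ.<-cmp p q
... | tri< p<q _ _ = contradiction (·-monoʳ-< k p<q) (ℚₚ.<-irrefl eq)
... | tri≈ _ p≡q _ = p≡q
... | tri> _ _ q<p = contradiction (·-monoʳ-< k q<p) (ℚₚ.<-irrefl (≡.sym eq))

-- The equation amounts to (v - u)(q - p) = 0. With v = u + 1 + k, cancelling `u · p ℚ.+ u · q`
-- leaves an equality of `suc k`-fold multiples.
·-cross-injective-< : ∀ {u v} p q → u ℕ.< v →
                      u · p ℚ.+ v · q ≡ u · q ℚ.+ v · p → p ≡ q
·-cross-injective-< {u} p q u<v eq with ℕₚ.m≤n⇒∃[o]m+o≡n u<v
... | k , refl = ≡.sym (·-injectiveʳ k (∙-cancelʳ (u · p ℚ.+ u · q) _ _ (begin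
  suc k · q ℚ.+ (u · p ℚ.+ u · q)   ≡⟨ solve 3 (λ a b c → a :+ (b :+ c) := b :+ (a :+ c)) refl (suc k · q) (u · p) (u · q) ⟩
  u · p ℚ.+ (suc k · q ℚ.+ u · q)   ≡⟨ cong (u · p ℚ.+_) (split q) ⟨
  u · p ℚ.+ (suc u ℕ.+ k) · q       ≡⟨ eq ⟩
  u · q ℚ.+ (suc u ℕ.+ k) · p       ≡⟨ cong (u · q ℚ.+_) (split p) ⟩
  u · q ℚ.+ (suc k · p ℚ.+ u · p)   ≡⟨ solve 3 (λ a b c → c :+ (a :+ b) := a :+ (b :+ c)) refl (suc k · p) (u · p) (u · q) ⟩
  suc k · p ℚ.+ (u · p ℚ.+ u · q)   ∎)))
  where
  open ≡.≡-Reasoning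
  open ℚ-Solver.+-*-Solver
  open AbelianGroupProperties ℚₚ.+-0-abelianGroup using (∙-cancelʳ)
  split : ∀ r → (suc u ℕ.+ k) · r ≡ suc k · r ℚ.+ u · r
  split r = ≡.trans (cong (λ m → suc m · r) (ℕₚ.+-comm u k))
                    (MonoidMult.×-homo-+ ℚₚ.+-0-monoid r (suc k) u)

·-cross-injective : ∀ {u v} p q → u ≢ v → u · p ℚ.+ v · q ≡ u · q ℚ.+ v · p → p ≡ q
·-cross-injective {u} {v} p q u≢v eq with ℕₚ.<-cmp u v
... | tri< u<v _ _ = ·-cross-injective-< p q u<v eq
... | tri≈ _ u≡v _ = contradiction u≡v u≢v
... | tri> _ _ v<u = ·-cross-injective-< p q v<u (begin
  v · p ℚ.+ u · q   ≡⟨ ℚₚ.+-comm (v · p) (u · q) ⟩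
  u · q ℚ.+ v · p   ≡⟨ eq ⟨
  u · p ℚ.+ v · q   ≡⟨ ℚₚ.+-comm (u · p) (v · q) ⟩
  v · q ℚ.+ u · p   ∎)
  where open ≡.≡-Reasoning

-- B_h-vectors through index lists

module IndexLists (em : ExcludedMiddle 0ℓ) (G : AbelianGroup 0ℓ 0ℓ) where

  open AbelianGroup G renaming (refl to ≈-refl; sym to ≈-sym; trans to ≈-trans)
  open SetoidPermutation setoid using (refl; prep; swap; trans; ↭-trans′)
    renaming (_↭_ to _↭ₛ_; ↭-sym to ↭ₛ-sym)

  infix 4 _≋_
  _≋_ : List Carrier → List Carrier → Set
  _≋_ = Pointwise _≈_

  sumAt : ∀ {n} → Vector Carrier n → List (Fin n) → Carrier
  sumAt a is = sum G (map a is)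

  -- The B_h condition on indices instead of values. It ranges over finitely many pairs of lists,
  -- and for positive `h` it also forces the coordinates to be distinct.
  SumsDistinct : ∀ {n} → ℕ → Vector Carrier n → Set
  SumsDistinct h a = ∀ is → length is ≡ h → ∀ js → length js ≡ h →
                     sumAt a is ≈ sumAt a js → is ↭ js

  module _ {n} (a : Vector Carrier n) where

    map-coordinates : ∀ is → All (Coordinates G a) (map a is)
    map-coordinates is = Allₚ.map⁺ (All.universal (λ i → i , ≈-refl) is)

    coordinates-indices : ∀ {u} → All (Coordinates G a) u → ∃[ is ] (u ≋ map a is)
    coordinates-indices [] = [] , []
    coordinates-indices ((i , x≈aᵢ) ∷ us) =
      let is , eqs = coordinates-indices us in i ∷ is , x≈aᵢ ∷ eqs

    map⁺-↭ : ∀ {is js} → is ↭ js → map a is ↭ₛ map a js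
    map⁺-↭ p = SetoidPermutationₚ.map⁺ (≡.setoid _) setoid (λ { refl → ≈-refl }) (↭.↭⇒↭ₛ p)

    -- Carries a labelling by indices along a permutation of values. The target is an arbitrary `v`
    -- because the middle list of a `trans` comes with no labelling of its own.
    ↭-preimage : ∀ {u v is} → u ↭ₛ v → u ≋ map a is → ∃[ js ] (v ≋ map a js × is ↭ js)
    ↭-preimage {is = is} (refl u≋v) u≋ =
      is , Pointwise.transitive ≈-trans (Pointwise.symmetric ≈-sym u≋v) u≋ , ↭.refl
    ↭-preimage {is = i ∷ _} (prep x≈y p) (e ∷ u≋) =
      let js , v≋ , q = ↭-preimage p u≋
      in i ∷ js , ≈-trans (≈-sym x≈y) e ∷ v≋ , ↭.prep i q
    ↭-preimage {is = i ∷ j ∷ _} (swap x≈ y≈ p) (e ∷ f ∷ u≋) =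
      let js , v≋ , q = ↭-preimage p u≋
      in j ∷ i ∷ js , ≈-trans (≈-sym y≈) f ∷ ≈-trans (≈-sym x≈) e ∷ v≋ , ↭.swap i j q
    ↭-preimage (trans p q) u≋ =
      let _ , v≋ , r = ↭-preimage p u≋
          ks , w≋ , s = ↭-preimage q v≋
      in ks , w≋ , ↭-trans r s

    map-injective : (∀ i j → i ≢ j → ¬ (a i ≈ a j)) → ∀ is js → map a is ≋ map a js → is ≡ js
    map-injective _ [] [] [] = refl
    map-injective distinct (i ∷ is) (j ∷ js) (e ∷ es) =
      cong₂ _∷_ (em⇒dne em λ i≢j → distinct i j i≢j e) (map-injective distinct is js es)

    -- The preimage `ks` labels the same values as `js`, and with distinct coordinates a value has
    -- only one label.
    map⁻-↭ : (∀ i j → i ≢ j → ¬ (a i ≈ a j)) → ∀ is js → map a is ↭ₛ map a js → is ↭ js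
    map⁻-↭ distinct is js p =
      let ks , ≋ks , q = ↭-preimage p (Pointwise.refl ≈-refl)
      in subst (is ↭_) (≡.sym (map-injective distinct js ks ≋ks)) q

    sumAt-replicate-cong : ∀ h {i j} → a i ≈ a j →
                           sumAt a (replicate h i) ≈ sumAt a (replicate h j)
    sumAt-replicate-cong zero _ = ≈-refl
    sumAt-replicate-cong (suc h) e = ∙-cong e (sumAt-replicate-cong h e)

    isBhVector⇒sumsDistinct : ∀ {h} → IsBhVector G h a → SumsDistinct h a
    isBhVector⇒sumsDistinct (distinct , bh) is |is| js |js| eq =
      map⁻-↭ distinct is js (bh (sumAt a js) (map a is) (map a js)
        (≡.trans (Listₚ.length-map a is) |is| , map-coordinates is , eq)
        (≡.trans (Listₚ.length-map a js) |js| , map-coordinates js , ≈-refl))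

    sumsDistinct⇒isBhVector : ∀ {h} → SumsDistinct (suc h) a → IsBhVector G (suc h) a
    sumsDistinct⇒isBhVector {h} sums = distinct , bh
      where
      distinct : ∀ i j → i ≢ j → ¬ (a i ≈ a j)
      -- If two coordinates agreed, repeating `i` and repeating `j` would give equal sums, so the
      -- two constant lists would be permutations of each other. They are nonempty, so comparing a
      -- head yields `j ≡ i`.
      distinct i j i≢j e = i≢j (≡.sym (All.head (↭ₚ.All-resp-↭
        (sums (replicate (suc h) i) (Listₚ.length-replicate (suc h))
              (replicate (suc h) j) (Listₚ.length-replicate (suc h))
              (sumAt-replicate-cong (suc h) e))
        (Allₚ.replicate⁺ {P = _≡ i} (suc h) refl))))

      bh : IsBhSet G (suc h) (Coordinates G a)
      bh x u v (|u| , us , u≈) (|v| , vs , v≈) =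
        let is , u≋ = coordinates-indices us
            js , v≋ = coordinates-indices vs
        in ↭-trans′ (refl u≋) (↭-trans′ (map⁺-↭ (sums
             is (≡.trans (length-indices is u≋) |u|)
             js (≡.trans (length-indices js v≋) |v|)
             (≈-trans (≈-sym (sum-cong u≋)) (≈-trans u≈ (≈-trans (≈-sym v≈) (sum-cong v≋))))))
             (↭ₛ-sym (refl v≋)))
        where
        length-indices : ∀ {w} ks → w ≋ map a ks → length ks ≡ length w
        length-indices ks w≋ = ≡.sym (≡.trans (Pointwise.Pointwise-length w≋) (Listₚ.length-map a ks))
        sum-cong : ∀ {w w′} → w ≋ w′ → sum G w ≈ sum G w′
        sum-cong [] = ≈-refl
        sum-cong (e ∷ es) = ∙-cong e (sum-cong es)

-- Groups with a notion of size

-- Within q x stands for ∣x∣ < q, and ι embeds ℚ.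
record Gauge (G : AbelianGroup 0ℓ 0ℓ) : Set₁ where
  open AbelianGroup G
  field
    Within      : ℚ → Carrier → Set
    resp        : ∀ q x y → x ≈ y → Within q x → Within q y
    mono        : ∀ p q x → p ℚ.≤ q → Within p x → Within q x
    zero-within : ∀ q → 0ℚ ℚ.< q → Within q ε
    ∙-within    : ∀ p q x y → Within p x → Within q y → Within (p ℚ.+ q) (x ∙ y)
    ⁻¹-within   : ∀ q x → Within q x → Within q (x ⁻¹)
    separated   : ∀ x → (∀ q → 0ℚ ℚ.< q → Within q x) → x ≈ ε
    ι           : ℚ → Carrier
    ι-homo      : ∀ p q → ι (p ℚ.+ q) ≈ ι p ∙ ι q
    ι-within    : ∀ p q → 0ℚ ℚ.< p → p ℚ.< q → Within q (ι p)
    ι-injective : ∀ p q → ι p ≈ ι q → p ≡ q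

module _ (em : ExcludedMiddle 0ℓ) {G : AbelianGroup 0ℓ 0ℓ} (gauge : Gauge G) where

  open AbelianGroup G renaming (refl to ≈-refl; sym to ≈-sym; trans to ≈-trans)
    hiding (_-_)
  open Gauge gauge
  open AbelianGroupProperties G
  open CommutativeSemigroupProperties commutativeSemigroup using (interchange)
  open IndexLists em G
  open import Relation.Binary.Reasoning.Setoid setoid

  -- Openness: sums vary continuously with the vector.

  Near : ∀ {n} → ℚ → Vector Carrier n → Vector Carrier n → Set
  Near q a b = ∀ i → Within q (b i ∙ a i ⁻¹)

  sumAt-near : ∀ {n} (a : Vector Carrier n) is δ → 0ℚ ℚ.< δ →
               Small (λ q → ∀ b → Near q a b → Within δ (sumAt b is ∙ sumAt a is ⁻¹))
  sumAt-near a [] δ 0<δ = small-always λ _ _ _ _ →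
    resp δ _ _ (≈-sym (inverseʳ ε)) (zero-within δ 0<δ)
  sumAt-near a (i ∷ is) δ 0<δ = small-map step
    -- Half of `δ` is allotted to the head coordinate and half to the remaining sum.
    (small-× (δ ℚ.* ½ , ½-pos 0<δ , λ q _ q≤ → q≤) (sumAt-near a is (δ ℚ.* ½) (½-pos 0<δ)))
    where
    step : ∀ q → 0ℚ ℚ.< q →
           q ℚ.≤ δ ℚ.* ½ × (∀ b → Near q a b → Within (δ ℚ.* ½) (sumAt b is ∙ sumAt a is ⁻¹)) →
           ∀ b → Near q a b → Within δ (sumAt b (i ∷ is) ∙ sumAt a (i ∷ is) ⁻¹)
    step q _ (q≤ , near) b b~a =
      resp δ _ _ regroup (subst (λ r → Within r _) (½+½ δ)
        (∙-within _ _ _ _ (mono _ _ _ q≤ (b~a i)) (near b b~a)))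
      where
      regroup : (b i ∙ a i ⁻¹) ∙ (sumAt b is ∙ sumAt a is ⁻¹) ≈
                (b i ∙ sumAt b is) ∙ (a i ∙ sumAt a is) ⁻¹
      regroup = ≈-trans (interchange _ _ _ _) (∙-congˡ (⁻¹-∙-comm _ _))

  -- By `separated`, the difference of the sums at `a` fails to lie within some `δ`. If each sum
  -- moves by less than half of `δ`, an equality at `b` would place that difference within `δ`.
  sums-stay-distinct : ∀ {n} (a : Vector Carrier n) is js → ¬ (sumAt a is ≈ sumAt a js) →
                       Small (λ q → ∀ b → Near q a b → ¬ (sumAt b is ≈ sumAt b js))
  sums-stay-distinct a is js differ
    with em {∃[ δ ] (0ℚ ℚ.< δ × ¬ Within δ (sumAt a is ∙ sumAt a js ⁻¹))}
  ... | no none = contradiction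
    (x∙y⁻¹≈ε⇒x≈y _ _ (separated _ λ δ 0<δ → em⇒dne em λ ¬w → none (δ , 0<δ , ¬w))) differ
  ... | yes (δ , 0<δ , ¬w) = small-map step
    (small-× (sumAt-near a is (δ ℚ.* ½) (½-pos 0<δ)) (sumAt-near a js (δ ℚ.* ½) (½-pos 0<δ)))
    where
    step : ∀ q → 0ℚ ℚ.< q →
           (∀ b → Near q a b → Within (δ ℚ.* ½) (sumAt b is ∙ sumAt a is ⁻¹)) ×
           (∀ b → Near q a b → Within (δ ℚ.* ½) (sumAt b js ∙ sumAt a js ⁻¹)) →
           ∀ b → Near q a b → ¬ (sumAt b is ≈ sumAt b js)
    step q _ (near-is , near-js) b b~a eq = ¬w (resp δ _ _ telescope
      (subst (λ r → Within r _) (½+½ δ)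
        (∙-within _ _ _ _ (⁻¹-within _ _ (near-is b b~a)) (near-js b b~a))))
      where
      telescope : (sumAt b is ∙ sumAt a is ⁻¹) ⁻¹ ∙ (sumAt b js ∙ sumAt a js ⁻¹) ≈
                  sumAt a is ∙ sumAt a js ⁻¹
      telescope = begin
        (sumAt b is ∙ sumAt a is ⁻¹) ⁻¹ ∙ (sumAt b js ∙ sumAt a js ⁻¹)
          ≈⟨ ∙-cong (⁻¹-anti-homo-// _ _) (∙-congʳ (≈-sym eq)) ⟩
        (sumAt a is ∙ sumAt b is ⁻¹) ∙ (sumAt b is ∙ sumAt a js ⁻¹)
          ≈⟨ assoc _ _ _ ⟩
        sumAt a is ∙ (sumAt b is ⁻¹ ∙ (sumAt b is ∙ sumAt a js ⁻¹))
          ≈⟨ ∙-congˡ (\\-leftDividesʳ _ _) ⟩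
        sumAt a is ∙ sumAt a js ⁻¹ ∎

  isBhVector-open : ∀ {n h} (a : Vector Carrier n) → IsBhVector G (suc h) a →
                    Small (λ q → ∀ b → Near q a b → IsBhVector G (suc h) b)
  isBhVector-open {n} {h} a bh = small-map
    (λ q _ f b b~a → sumsDistinct⇒isBhVector b λ is |is| js |js| → f is |is| js |js| b b~a)
    (small-lists (suc h) λ is |is| → small-lists (suc h) λ js |js| → stay is js |is| |js|)
    where
    stay : ∀ is js → length is ≡ suc h → length js ≡ suc h →
           Small (λ q → ∀ b → Near q a b → sumAt b is ≈ sumAt b js → is ↭ js)
    -- Permuted lists impose no condition on `b`; all other pairs have different sums at `a`.
    stay is js |is| |js| with em {is ↭ js}
    ... | yes p = small-always λ _ _ _ _ _ → p
    ... | no ¬p = small-map (λ q _ f b b~a eq → ⊥-elim (f b b~a eq))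
      (sums-stay-distinct a is js λ eq → ¬p (isBhVector⇒sumsDistinct a bh is |is| js |js| eq))

  -- Density: shifting along powers of the base.

  ι-0 : ι 0ℚ ≈ ε
  ι-0 = identityʳ-unique _ _ (≈-sym (ι-homo 0ℚ 0ℚ))

  -- The multiple is an iterated sum: half of `δ` covers one copy of `q`, the other half the
  -- remaining copies.
  ι-small : ∀ m δ → 0ℚ ℚ.< δ → Small (λ q → Within δ (ι (m · q)))
  ι-small zero δ 0<δ = small-always λ _ _ → resp δ _ _ (≈-sym ι-0) (zero-within δ 0<δ)
  ι-small (suc m) δ 0<δ = small-map
    (λ q 0<q (q< , w) → resp δ _ _ (≈-sym (ι-homo q (m · q)))
      (subst (λ r → Within r _) (½+½ δ) (∙-within _ _ _ _ (ι-within _ _ 0<q q<) w)))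
    (small-× (small-< (½-pos 0<δ)) (ι-small m (δ ℚ.* ½) (½-pos 0<δ)))

  shift : ∀ {n} → ℕ → ℚ → Vector Carrier n → Vector Carrier n
  shift B q a i = a i ∙ ι ((B ^ toℕ i) · q)

  -- The shift acts on a sum only through the weight of its index list.
  sumAt-shift : ∀ {n} B q (a : Vector Carrier n) is →
                sumAt (shift B q a) is ≈ sumAt a is ∙ ι (weight B is · q)
  sumAt-shift B q a [] = ≈-sym (≈-trans (identityˡ _) ι-0)
  sumAt-shift B q a (i ∷ is) = begin
    shift B q a i ∙ sumAt (shift B q a) is
      ≈⟨ ∙-congˡ (sumAt-shift B q a is) ⟩
    (a i ∙ ι (w · q)) ∙ (sumAt a is ∙ ι (v · q))
      ≈⟨ interchange _ _ _ _ ⟩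
    (a i ∙ sumAt a is) ∙ (ι (w · q) ∙ ι (v · q))
      ≈⟨ ∙-congˡ (ι-homo (w · q) (v · q)) ⟨
    (a i ∙ sumAt a is) ∙ ι (w · q ℚ.+ v · q)
      ≡⟨ cong (λ r → (a i ∙ sumAt a is) ∙ ι r) (MonoidMult.×-homo-+ ℚₚ.+-0-monoid q w v) ⟨
    (a i ∙ sumAt a is) ∙ ι ((w ℕ.+ v) · q) ∎
    where
    w = B ^ toℕ i
    v = weight B is

  -- The collision at `p` is combined with the reversed collision at `q`. Both sides then contain
  -- `S ∙ T`, whose cancellation leaves the cross equation for the weights under `ι`.
  shift-collision-unique : ∀ {n} B (a : Vector Carrier n) is js → weight B is ≢ weight B js →
    ∀ p q → sumAt (shift B p a) is ≈ sumAt (shift B p a) js →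
            sumAt (shift B q a) is ≈ sumAt (shift B q a) js → p ≡ q
  shift-collision-unique B a is js u≢v p q eqₚ eq_q =
    ·-cross-injective p q u≢v (ι-injective _ _ (begin
      ι (u · p ℚ.+ v · q)        ≈⟨ ι-homo (u · p) (v · q) ⟩
      ι (u · p) ∙ ι (v · q)      ≈⟨ ∙-cancelˡ (S ∙ T) _ _ crossed ⟩
      ι (u · q) ∙ ι (v · p)      ≈⟨ ι-homo (u · q) (v · p) ⟨
      ι (u · q ℚ.+ v · p)        ∎))
    where
    u = weight B is
    v = weight B js
    S = sumAt a is
    T = sumAt a js
    collision : ∀ r → sumAt (shift B r a) is ≈ sumAt (shift B r a) js →
                S ∙ ι (u · r) ≈ T ∙ ι (v · r)
    collision r eq = ≈-trans (≈-sym (sumAt-shift B r a is)) (≈-trans eq (sumAt-shift B r a js))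
    crossed : (S ∙ T) ∙ (ι (u · p) ∙ ι (v · q)) ≈ (S ∙ T) ∙ (ι (u · q) ∙ ι (v · p))
    crossed = begin
      (S ∙ T) ∙ (ι (u · p) ∙ ι (v · q))    ≈⟨ interchange _ _ _ _ ⟩
      (S ∙ ι (u · p)) ∙ (T ∙ ι (v · q))    ≈⟨ ∙-cong (collision p eqₚ) (≈-sym (collision q eq_q)) ⟩
      (T ∙ ι (v · p)) ∙ (S ∙ ι (u · q))    ≈⟨ comm _ _ ⟩
      (S ∙ ι (u · q)) ∙ (T ∙ ι (v · p))    ≈⟨ interchange _ _ _ _ ⟩
      (S ∙ T) ∙ (ι (u · q) ∙ ι (v · p))    ∎

  isBhVector-dense : ∀ {n h} (a : Vector Carrier n) δ → 0ℚ ℚ.< δ →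
                     ∃[ b ] (Near δ a b × IsBhVector G (suc h) b)
  isBhVector-dense {n} {h} a δ 0<δ =
    let ρ , 0<ρ , f = small-× near (small-lists (suc h) λ is |is| →
                                    small-lists (suc h) λ js |js| → avoid is js |is| |js|)
        b~a , sums = f ρ 0<ρ ℚₚ.≤-refl
    in shift B ρ a , b~a , sumsDistinct⇒isBhVector _ sums
    where
    -- One more than the common length `suc h` of the lists, as `weight-injective` demands.
    B = suc (suc h)
    near : Small (λ q → Near δ a (shift B q a))
    near = small-Fin λ i → small-map (λ q _ → resp δ _ _ (≈-sym (xyx⁻¹≈y _ _)))
                                     (ι-small (B ^ toℕ i) δ 0<δ)
    avoid : ∀ is js → length is ≡ suc h → length js ≡ suc h →
            Small (λ q → sumAt (shift B q a) is ≈ sumAt (shift B q a) js → is ↭ js)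
    avoid is js |is| |js| with weight B is ℕₚ.≟ weight B js
    ... | yes u≡v = small-always λ _ _ _ → weight-injective is js
      (s≤s (ℕₚ.≤-reflexive |is|)) (s≤s (ℕₚ.≤-reflexive |js|)) u≡v
    -- Different weights allow a collision for at most one `q`.
    ... | no u≢v = small-map (λ _ _ ¬eq eq → ⊥-elim (¬eq eq))
      (small-avoids em (shift-collision-unique B a is js u≢v))

_×-gauge_ : ∀ {G H} → Gauge G → Gauge H → Gauge (DirectProduct.abelianGroup G H)
_×-gauge_ {G} {H} g h = record
  { Within      = λ { q (x , y) → G.Within q x × H.Within q y }
  ; resp        = λ { q _ _ (e , f) (v , w) → G.resp q _ _ e v , H.resp q _ _ f w }
  ; mono        = λ { p q _ p≤q (v , w) → G.mono p q _ p≤q v , H.mono p q _ p≤q w }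
  ; zero-within = λ q 0<q → G.zero-within q 0<q , H.zero-within q 0<q
  ; ∙-within    = λ { p q _ _ (v , w) (v′ , w′) → G.∙-within p q _ _ v v′ , H.∙-within p q _ _ w w′ }
  ; ⁻¹-within   = λ { q _ (v , w) → G.⁻¹-within q _ v , H.⁻¹-within q _ w }
  ; separated   = λ { _ f → G.separated _ (λ q 0<q → proj₁ (f q 0<q))
                          , H.separated _ (λ q 0<q → proj₂ (f q 0<q)) }
  -- The diagonal embedding; over ℂ the vector is thus shifted by multiples of q + iq.
  ; ι           = λ q → G.ι q , H.ι q
  ; ι-homo      = λ p q → G.ι-homo p q , H.ι-homo p q
  ; ι-within    = λ p q 0<p p<q → G.ι-within p q 0<p p<q , H.ι-within p q 0<p p<q
  ; ι-injective = λ { p q (e , _) → G.ι-injective p q e }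
  }
  where
  module G = Gauge g
  module H = Gauge h

-- The real and complex numbers

∣p-q∣-arbitrarily-small : ∀ {p q} → (∀ ε → 0ℚ ℚ.< ε → ℚ.∣ p ℚ.- q ∣ ℚ.< ε) → p ≡ q
∣p-q∣-arbitrarily-small {p} {q} small with ℚₚ.<-cmp 0ℚ ℚ.∣ p ℚ.- q ∣
... | tri< 0<d _ _ = contradiction (small _ 0<d) (ℚₚ.<-irrefl refl)
... | tri≈ _ 0≡d _ = x∙y⁻¹≈ε⇒x≈y p q (ℚₚ.∣p∣≡0⇒p≡0 (p ℚ.- q) (≡.sym 0≡d))
  where open AbelianGroupProperties ℚₚ.+-0-abelianGroup using (x∙y⁻¹≈ε⇒x≈y)
... | tri> _ _ d<0 = contradiction (ℚₚ.<-≤-trans d<0 (ℚₚ.0≤∣p∣ (p ℚ.- q))) (ℚₚ.<-irrefl refl)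

∣p∣*∣p∣≡p*p : ∀ p → ℚ.∣ p ∣ ℚ.* ℚ.∣ p ∣ ≡ p ℚ.* p
∣p∣*∣p∣≡p*p p with ℚₚ.∣p∣≡p∨∣p∣≡-p p
... | inj₁ eq = cong₂ ℚ._*_ eq eq
... | inj₂ eq = ≡.trans (cong₂ ℚ._*_ eq eq) (solve 1 (λ p → :- p :* :- p := p :* p) refl p)
  where open ℚ-Solver.+-*-Solver

0≤p*p : ∀ p → 0ℚ ℚ.≤ p ℚ.* p
0≤p*p p = subst₂ ℚ._≤_ (ℚₚ.*-zeroˡ ℚ.∣ p ∣) (∣p∣*∣p∣≡p*p p)
  (ℚₚ.*-monoʳ-≤-nonNeg ℚ.∣ p ∣ {{ℚₚ.∣-∣-nonNeg p}} (ℚₚ.0≤∣p∣ p))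

square-mono-≤ : ∀ {p q} → ℚ.∣ p ∣ ℚ.≤ q → p ℚ.* p ℚ.≤ q ℚ.* q
square-mono-≤ {p} {q} p≤q = begin
  p ℚ.* p               ≡⟨ ∣p∣*∣p∣≡p*p p ⟨
  ℚ.∣ p ∣ ℚ.* ℚ.∣ p ∣   ≤⟨ ℚₚ.*-monoʳ-≤-nonNeg ℚ.∣ p ∣ {{ℚₚ.∣-∣-nonNeg p}} p≤q ⟩
  q ℚ.* ℚ.∣ p ∣         ≤⟨ ℚₚ.*-monoˡ-≤-nonNeg q {{ℚ.nonNegative (ℚₚ.≤-trans (ℚₚ.0≤∣p∣ p) p≤q)}} p≤q ⟩
  q ℚ.* q               ∎
  where open ℚₚ.≤-Reasoning

square-cancel-≤ : ∀ {p q} → 0ℚ ℚ.< q → p ℚ.* p ℚ.≤ q ℚ.* q → ℚ.∣ p ∣ ℚ.≤ q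
square-cancel-≤ {p} {q} 0<q p²≤q² = ℚₚ.≮⇒≥ λ q<p → ℚₚ.<-irrefl refl (begin-strict
  q ℚ.* q               <⟨ ℚₚ.*-monoʳ-<-pos q {{ℚ.positive 0<q}} q<p ⟩
  q ℚ.* ℚ.∣ p ∣         ≤⟨ ℚₚ.*-monoʳ-≤-nonNeg ℚ.∣ p ∣ {{ℚₚ.∣-∣-nonNeg p}} (ℚₚ.<⇒≤ q<p) ⟩
  ℚ.∣ p ∣ ℚ.* ℚ.∣ p ∣   ≡⟨ ∣p∣*∣p∣≡p*p p ⟩
  p ℚ.* p               ≤⟨ p²≤q² ⟩
  q ℚ.* q               ∎)
  where open ℚₚ.≤-Reasoning

⊔-≤ˡ : ∀ {k} m n → m ℕ.⊔ n ≤ k → m ≤ k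
⊔-≤ˡ = ℕₚ.m⊔n≤o⇒m≤o

⊔-≤ʳ : ∀ {k} m n → m ℕ.⊔ n ≤ k → n ≤ k
⊔-≤ʳ = ℕₚ.m⊔n≤o⇒n≤o

-- Half of the margin `δ` absorbs the eventual distance between the sequences; the other half
-- survives as the new margin.
∣x∣<-resp-≃ : ∀ q x y → x ≃ y → ∣ x ∣ < fromℚ q → ∣ y ∣ < fromℚ q
∣x∣<-resp-≃ q x y x≃y (δ , 0<δ , N , f) =
  let M , g = x≃y (δ ℚ.* ½) (½-pos 0<δ)
  in δ ℚ.* ½ , ½-pos 0<δ , N ℕ.⊔ M , λ n n≥ →
     bound (seq x n) (seq y n) (f n (⊔-≤ˡ N M n≥)) (g n (⊔-≤ʳ N M n≥))
  where
  open ℚₚ.≤-Reasoning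
  open ℚ-Solver.+-*-Solver
  bound : ∀ p r → ℚ.∣ p ∣ ℚ.+ δ ℚ.≤ q → ℚ.∣ p ℚ.- r ∣ ℚ.< δ ℚ.* ½ →
          ℚ.∣ r ∣ ℚ.+ δ ℚ.* ½ ℚ.≤ q
  bound p r p≤ d< = begin
    ℚ.∣ r ∣ ℚ.+ δ ℚ.* ½
      ≡⟨ cong (λ t → ℚ.∣ t ∣ ℚ.+ δ ℚ.* ½) (solve 2 (λ p r → r := p :+ (:- (p :- r))) refl p r) ⟩
    ℚ.∣ p ℚ.+ ℚ.- (p ℚ.- r) ∣ ℚ.+ δ ℚ.* ½
      ≤⟨ ℚₚ.+-monoˡ-≤ (δ ℚ.* ½) (ℚₚ.∣p+q∣≤∣p∣+∣q∣ p (ℚ.- (p ℚ.- r))) ⟩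
    ℚ.∣ p ∣ ℚ.+ ℚ.∣ ℚ.- (p ℚ.- r) ∣ ℚ.+ δ ℚ.* ½
      ≡⟨ cong (λ t → ℚ.∣ p ∣ ℚ.+ t ℚ.+ δ ℚ.* ½) (ℚₚ.∣-p∣≡∣p∣ (p ℚ.- r)) ⟩
    ℚ.∣ p ∣ ℚ.+ ℚ.∣ p ℚ.- r ∣ ℚ.+ δ ℚ.* ½
      ≤⟨ ℚₚ.+-monoˡ-≤ (δ ℚ.* ½) (ℚₚ.+-monoʳ-≤ ℚ.∣ p ∣ (ℚₚ.<⇒≤ d<)) ⟩
    ℚ.∣ p ∣ ℚ.+ δ ℚ.* ½ ℚ.+ δ ℚ.* ½
      ≡⟨ ≡.trans (ℚₚ.+-assoc ℚ.∣ p ∣ _ _) (cong (ℚ.∣ p ∣ ℚ.+_) (½+½ δ)) ⟩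
    ℚ.∣ p ∣ ℚ.+ δ
      ≤⟨ p≤ ⟩
    q ∎

∣x∣<-+ : ∀ p q x y → ∣ x ∣ < fromℚ p → ∣ y ∣ < fromℚ q → ∣ x + y ∣ < fromℚ (p ℚ.+ q)
∣x∣<-+ p q x y (δ , 0<δ , N , f) (γ , 0<γ , M , g) =
  δ ℚ.+ γ , ℚₚ.+-mono-< 0<δ 0<γ , N ℕ.⊔ M , λ n n≥ → begin
    ℚ.∣ seq x n ℚ.+ seq y n ∣ ℚ.+ (δ ℚ.+ γ)
      ≤⟨ ℚₚ.+-monoˡ-≤ (δ ℚ.+ γ) (ℚₚ.∣p+q∣≤∣p∣+∣q∣ (seq x n) (seq y n)) ⟩
    ℚ.∣ seq x n ∣ ℚ.+ ℚ.∣ seq y n ∣ ℚ.+ (δ ℚ.+ γ)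
      ≡⟨ interchange ℚ.∣ seq x n ∣ ℚ.∣ seq y n ∣ δ γ ⟩
    (ℚ.∣ seq x n ∣ ℚ.+ δ) ℚ.+ (ℚ.∣ seq y n ∣ ℚ.+ γ)
      ≤⟨ ℚₚ.+-mono-≤ (f n (⊔-≤ˡ N M n≥)) (g n (⊔-≤ʳ N M n≥)) ⟩
    p ℚ.+ q ∎
  where
  open ℚₚ.≤-Reasoning
  open CommutativeSemigroupProperties
    (AbelianGroup.commutativeSemigroup ℚₚ.+-0-abelianGroup) using (interchange)

p<q⇒0<q-p : ∀ {p q} → p ℚ.< q → 0ℚ ℚ.< q ℚ.- p
p<q⇒0<q-p {p} {q} p<q = subst (ℚ._< q ℚ.- p) (ℚₚ.+-inverseʳ p) (ℚₚ.+-monoˡ-< (ℚ.- p) p<q)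

p+[q-p]≡q : ∀ p q → p ℚ.+ (q ℚ.- p) ≡ q
p+[q-p]≡q = solve 2 (λ p q → p :+ (q :- p) := q) refl
  where open ℚ-Solver.+-*-Solver

p<p+δ : ∀ p {δ} → 0ℚ ℚ.< δ → p ℚ.< p ℚ.+ δ
p<p+δ p 0<δ = subst (ℚ._< p ℚ.+ _) (ℚₚ.+-identityʳ p) (ℚₚ.+-monoʳ-< p 0<δ)

∣fromℚ∣<fromℚ : ∀ p q → 0ℚ ℚ.≤ p → p ℚ.< q → ∣ fromℚ p ∣ < fromℚ q
∣fromℚ∣<fromℚ p q 0≤p p<q = q ℚ.- p , p<q⇒0<q-p p<q , 0 , λ _ _ →
  ℚₚ.≤-reflexive (≡.trans (cong (ℚ._+ (q ℚ.- p)) (ℚₚ.0≤p⇒∣p∣≡p 0≤p)) (p+[q-p]≡q p q))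

ℝ-gauge : Gauge ℝ-abelianGroup
ℝ-gauge = record
  { Within      = λ q x → ∣ x ∣ < fromℚ q
  ; resp        = ∣x∣<-resp-≃
  ; mono        = λ { p q x p≤q (δ , 0<δ , N , f) →
                      δ , 0<δ , N , λ n n≥ → ℚₚ.≤-trans (f n n≥) p≤q }
  ; zero-within = λ q 0<q → ∣fromℚ∣<fromℚ 0ℚ q ℚₚ.≤-refl 0<q
  ; ∙-within    = ∣x∣<-+
  ; ⁻¹-within   = λ { q x (δ , 0<δ , N , f) → δ , 0<δ , N , λ n n≥ →
                      subst (λ r → r ℚ.+ δ ℚ.≤ q) (≡.sym (ℚₚ.∣-p∣≡∣p∣ (seq x n))) (f n n≥) }
  ; separated   = λ x small ε 0<ε → let δ , 0<δ , N , f = small ε 0<ε in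
                  N , λ n n≥ → subst (λ r → ℚ.∣ r ∣ ℚ.< ε) (≡.sym (ℚₚ.+-identityʳ (seq x n)))
                    (ℚₚ.<-≤-trans (p<p+δ ℚ.∣ seq x n ∣ 0<δ) (f n n≥))
  ; ι           = fromℚ
  ; ι-homo      = λ p q → AbelianGroup.refl ℝ-abelianGroup {fromℚ (p ℚ.+ q)}
  ; ι-within    = λ p q 0<p → ∣fromℚ∣<fromℚ p q (ℚₚ.<⇒≤ 0<p)
  -- The sequences are constant, so a single late index already bounds the distance between `p` and
  -- `q` by every `ε`.
  ; ι-injective = λ p q eq → ∣p-q∣-arbitrarily-small λ ε 0<ε →
                  let N , f = eq ε 0<ε in f N ℕₚ.≤-refl
  }

-- On ℂ the maximum of the parts' absolute values serves as size, which spares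
-- the triangle inequality for the modulus.
gaugeOf : ∀ K → Gauge (additiveGroup K)
gaugeOf real    = ℝ-gauge
gaugeOf complex = ℝ-gauge ×-gauge ℝ-gauge

-- The radius is doubled because x² + y² + δ ≤ q² bounds ∣x∣ by q, but
-- exhibits no margin below q.
absLess⇒within : ∀ K q z → 0ℚ ℚ.< q → AbsLess K z (fromℚ q) →
                 Gauge.Within (gaugeOf K) (q ℚ.+ q) z
absLess⇒within real q x 0<q (δ , 0<δ , N , f) = δ , 0<δ , N , λ n n≥ →
  ℚₚ.≤-trans (f n n≥) (ℚₚ.<⇒≤ (p<p+δ q 0<q))
absLess⇒within complex q (x , y) 0<q (_ , δ , 0<δ , N , f) =
  (q , 0<q , N , λ n n≥ → ℚₚ.+-monoˡ-≤ q (square-cancel-≤ {seq x n} 0<q (part x y n (f n n≥)))) ,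
  (q , 0<q , N , λ n n≥ → ℚₚ.+-monoˡ-≤ q (square-cancel-≤ {seq y n} 0<q (part y x n
    (subst (λ t → t ℚ.+ δ ℚ.≤ q ℚ.* q) (ℚₚ.+-comm (seq (x * x) n) (seq (y * y) n)) (f n n≥)))))
  where
  open ℚₚ.≤-Reasoning
  part : ∀ u v n → seq (u * u + v * v) n ℚ.+ δ ℚ.≤ q ℚ.* q → seq u n ℚ.* seq u n ℚ.≤ q ℚ.* q
  part u v n u²+v²+δ≤q² = begin
    seq (u * u) n
      ≡⟨ ≡.trans (ℚₚ.+-identityʳ _) (ℚₚ.+-identityʳ _) ⟨
    seq (u * u) n ℚ.+ 0ℚ ℚ.+ 0ℚ
      ≤⟨ ℚₚ.+-mono-≤ (ℚₚ.+-monoʳ-≤ (seq (u * u) n) (0≤p*p (seq v n))) (ℚₚ.<⇒≤ 0<δ) ⟩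
    seq (u * u) n ℚ.+ seq (v * v) n ℚ.+ δ
      ≤⟨ u²+v²+δ≤q² ⟩
    q ℚ.* q ∎

-- Positivity of `r` supplies a rational `ρ` that eventually bounds its sequence from below, and the
-- size is compared with `ρ`.
within⇒absLess : ∀ K r → 0ℝ < r →
                 ∃[ δ ] (0ℚ ℚ.< δ × (∀ z → Gauge.Within (gaugeOf K) δ z → AbsLess K z r))
within⇒absLess real r (ρ , 0<ρ , N , f) = ρ , 0<ρ , λ { x (δ , 0<δ , M , g) →
  δ , 0<δ , N ℕ.⊔ M , λ n n≥ → ℚₚ.≤-trans (g n (⊔-≤ʳ N M n≥))
    (subst (ℚ._≤ seq r n) (ℚₚ.+-identityˡ ρ) (f n (⊔-≤ˡ N M n≥))) }
within⇒absLess complex r 0<r@(ρ , 0<ρ , N , f) =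
  δ , 0<δ , λ { (x , y) (w , w′) → 0<r , x²+y²<r² x y w w′ }
  where
  open ℚₚ.≤-Reasoning
  δ : ℚ
  -- With parts bounded by `δ`, x² + y² is at most 2δ². A margin of another 2δ² brings the total to
  -- 4δ² = ρ², which is eventually at most r².
  δ = ρ ℚ.* ½
  0<δ : 0ℚ ℚ.< δ
  0<δ = ½-pos 0<ρ
  0<δ² : 0ℚ ℚ.< δ ℚ.* δ
  0<δ² = subst (ℚ._< δ ℚ.* δ) (ℚₚ.*-zeroˡ δ) (ℚₚ.*-monoˡ-<-pos δ {{ℚ.positive 0<δ}} 0<δ)
  4δ²≡ρ² : δ ℚ.* δ ℚ.+ δ ℚ.* δ ℚ.+ (δ ℚ.* δ ℚ.+ δ ℚ.* δ) ≡ ρ ℚ.* ρ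
  4δ²≡ρ² = solve 1 (λ ρ → let d² = (ρ :* con ½) :* (ρ :* con ½) in
                     d² :+ d² :+ (d² :+ d²) := ρ :* ρ) refl ρ
    where open ℚ-Solver.+-*-Solver
  square-below : ∀ u γ → 0ℚ ℚ.< γ → ∀ n → ℚ.∣ seq u n ∣ ℚ.+ γ ℚ.≤ δ →
                 seq u n ℚ.* seq u n ℚ.≤ δ ℚ.* δ
  square-below u γ 0<γ n u+γ≤δ =
    square-mono-≤ (ℚₚ.≤-trans (ℚₚ.<⇒≤ (p<p+δ ℚ.∣ seq u n ∣ 0<γ)) u+γ≤δ)
  x²+y²<r² : ∀ x y → ∣ x ∣ < fromℚ δ → ∣ y ∣ < fromℚ δ → x * x + y * y < r * r
  x²+y²<r² x y (γ , 0<γ , L , g) (γ′ , 0<γ′ , M , g′) =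
    δ ℚ.* δ ℚ.+ δ ℚ.* δ , ℚₚ.+-mono-< 0<δ² 0<δ² , N ℕ.⊔ (L ℕ.⊔ M) , λ n n≥ → begin
      seq (x * x) n ℚ.+ seq (y * y) n ℚ.+ (δ ℚ.* δ ℚ.+ δ ℚ.* δ)
        ≤⟨ ℚₚ.+-monoˡ-≤ (δ ℚ.* δ ℚ.+ δ ℚ.* δ) (ℚₚ.+-mono-≤
             (square-below x γ 0<γ n (g n (⊔-≤ˡ L M (⊔-≤ʳ N (L ℕ.⊔ M) n≥))))
             (square-below y γ′ 0<γ′ n (g′ n (⊔-≤ʳ L M (⊔-≤ʳ N (L ℕ.⊔ M) n≥))))) ⟩
      δ ℚ.* δ ℚ.+ δ ℚ.* δ ℚ.+ (δ ℚ.* δ ℚ.+ δ ℚ.* δ)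
        ≡⟨ 4δ²≡ρ² ⟩
      ρ ℚ.* ρ
        ≤⟨ square-mono-≤ (subst (ℚ._≤ seq r n)
             (≡.trans (ℚₚ.+-identityˡ ρ) (≡.sym (ℚₚ.0≤p⇒∣p∣≡p (ℚₚ.<⇒≤ 0<ρ))))
             (f n (⊔-≤ˡ N (L ℕ.⊔ M) n≥))) ⟩
      seq r n ℚ.* seq r n ∎

theorem3 : ExcludedMiddle 0ℓ →
    (K : Scalars) (h n : ℕ) → 2 ≤ h → 2 ≤ n →
    IsOpen K {n} (IsBhVector (additiveGroup K) h) ×
    IsDense K {n} (IsBhVector (additiveGroup K) h)
theorem3 em K (suc h) n _ _ = isOpen , isDense
  where
  isOpen : IsOpen K {n} (IsBhVector (additiveGroup K) (suc h))
  isOpen a bh =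
    let ρ , 0<ρ , f = isBhVector-open em (gaugeOf K) a bh
    -- The radius is half of `ρ` because `absLess⇒within` doubles it.
    in fromℚ (ρ ℚ.* ½) , (ρ ℚ.* ½ , ½-pos 0<ρ , 0 , λ _ _ → ℚₚ.≤-reflexive (ℚₚ.+-identityˡ _)) ,
       λ b b~a → f ρ 0<ρ ℚₚ.≤-refl b λ i →
         subst (λ q → Gauge.Within (gaugeOf K) q _) (½+½ ρ)
           (absLess⇒within K (ρ ℚ.* ½) _ (½-pos 0<ρ) (b~a i))

  isDense : IsDense K {n} (IsBhVector (additiveGroup K) (suc h))
  isDense a r 0<r =
    let δ , 0<δ , f = within⇒absLess K r 0<r
        b , b~a , bh = isBhVector-dense em (gaugeOf K) a δ 0<δ
    in b , (λ i → f _ (b~a i)) , bh
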